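{- Consider a well-defined ADT with sorts $\sigma^d_1,\dots,\sigma^d_k$ and constructors $f_1,\dots,f_m$ in which every sort contains at least two constructor terms, and let $D$ be its dependency graph. The ADT is \emph{not} expanding if and only if $D$ contains a simple cycle $C=\sigma^1\to f^1\to\sigma^2\to f^2\to\cdots\to f^n\to\sigma^1$ (with $\sigma^1,\dots,\sigma^n$ sorts and $f^1,\dots,f^n$ constructors) with the following properties: 1. $C$ is the only path from $\sigma^1$ to itself, i.e., every cycle in $D$ (not necessarily simple) starting and ending in $\sigma^1$ is a repetition of $C$; 2. all constructors $f^1,f^2,\dots,f^n$ on $C$ are unary; 3. the cycle $C$ unboundedly contributes to the size image $\mathbb{S}_{\sigma^1}$, i.e., for all $k\in\mathbb{N}$, $$\mathbb{S}_{\sigma^1}\neq\{0,\dots,k\}\cdot n+\bigcup_{i=1}^n\big(\mathbb{S}^{f^i}_{\sigma^i}+i-1\big).$$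
   Context: **ADTs.** An ADT is given by finitely many sorts $\sigma^d_1,\dots,\sigma^d_k$ and finitely many constructors $f_1,\dots,f_m$, each with a type $f_i:\sigma_1\times\cdots\times\sigma_n\to\sigma_0$ with all $\sigma_j\in\{\sigma^d_1,\dots,\sigma^d_k\}$ ($n=0$ allowed). $\mathbb{T}_\sigma$ is the set of constructor terms (well-sorted ground terms built only from constructors) of sort $\sigma$. The ADT is well-defined if $\mathbb{T}_\sigma\neq\emptyset$ for every sort $\sigma$. The size $|t|$ of a constructor term is the number of constructor occurrences in $t$. **Expanding.** Let $\mathbb{T}^b_\sigma=\{t\in\mathbb{T}_\sigma\mid |t|=b\}$. A sort $\sigma$ is expanding if for every $n\in\mathbb{N}$ there is $b\in\mathbb{N}$ such that for every $b'\ge b$ either $\mathbb{T}^{b'}_\sigma=\emptyset$ or $|\mathbb{T}^{b'}_\sigma|\ge n$. An ADT is expanding if each of its sorts is expanding. **Size images.** $\mathbb{S}_\sigma=\{|t|\mid t\in\mathbb{T}_\sigma\}$, and for a constructor $f$, $\mathbb{S}^f_\sigma=\{|t|\mid t\in\mathbb{T}_\sigma,\ \text{the head symbol of } t \text{ is not } f\}$. For sets $A,B\subseteq\mathbb{N}$ and $c\in\mathbb{N}$: $A\cdot c=\{ac\mid a\in A\}$, $A+B=\{a+b\mid a\in A,b\in B\}$, and $A+i-1=\{a+i-1\mid a\in A\}$. **Dependency graph.** $D=(V,E)$ is the bipartite directed graph with $V=\{\sigma^d_1,\dots,\sigma^d_k\}\cup\{f_1,\dots,f_m\}$ and $E$ consisting,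 for each constructor $f_j:\sigma_1\times\cdots\times\sigma_n\to\sigma_0$, of the edges $(\sigma_0,f_j),(f_j,\sigma_1),\dots,(f_j,\sigma_n)$. A cycle is simple if no vertex is repeated except that the first equals the last. -}

module Defs where

open import Data.Fin using (Fin; toℕ)
open import Data.List using (List; []; _∷_; _∷ʳ_; head; length; concat; replicate)
open import Data.List.Membership.Propositional using () renaming (_∈_ to _∈ˡ_)
open import Data.List.Relation.Unary.All using (All; []; _∷_)
open import Data.List.Relation.Unary.Linked using (Linked)
open import Data.List.Relation.Unary.Unique.Propositional using (Unique)
open import Data.Maybe using (just)
open import Data.Nat using (ℕ; suc; _+_; _*_; _≤_)
open import Data.Product using (Σ-syntax; ∃-syntax; _×_; _,_; proj₁; proj₂)
open import Data.Sum using (_⊎_; inj₁; inj₂)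
open import Data.Vec using (Vec; []; _∷_; lookup)
open import Function.Bundles using (_↣_)
open import Level using (0ℓ)
open import Relation.Binary.PropositionalEquality using (_≡_; _≢_)
open import Relation.Nullary using (¬_)
open import Relation.Unary using (Pred; _∈_; ⋃; _≐_)

record ADT : Set where
  field
    #sorts : ℕ
    #ctors : ℕ
    dom : Fin #ctors → List (Fin #sorts)
    cod : Fin #ctors → Fin #sorts

  Sort Ctor : Set
  Sort = Fin #sorts
  Ctor = Fin #ctors

open ADT public using (Sort; Ctor)

AtLeast : ℕ → Set → Set
AtLeast n X = Fin n ↣ X

[0⋯_] : ℕ → Pred ℕ 0ℓ
[0⋯ k ] x = x ≤ k

infixl 7 _·_
infixl 6 _⊕_ _⊕ˢ_

_·_ : Pred ℕ 0ℓ → ℕ → Pred ℕ 0ℓ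
(A · c) x = ∃[ a ] a ∈ A × x ≡ a * c

_⊕_ : Pred ℕ 0ℓ → Pred ℕ 0ℓ → Pred ℕ 0ℓ
(A ⊕ B) x = ∃[ a ] ∃[ b ] a ∈ A × b ∈ B × x ≡ a + b

_⊕ˢ_ : Pred ℕ 0ℓ → ℕ → Pred ℕ 0ℓ
(A ⊕ˢ c) x = ∃[ a ] a ∈ A × x ≡ a + c

module _ (𝔸 : ADT) where
  open ADT 𝔸 using (dom; cod)

  data Term : Sort 𝔸 → Set where
    con : (f : Ctor 𝔸) → All Term (dom f) → Term (cod f)

  headSymbol : ∀ {σ} → Term σ → Ctor 𝔸
  headSymbol (con f _) = f

  mutual
    size : ∀ {σ} → Term σ → ℕ
    size (con _ ts) = suc (sizes ts)

    sizes : ∀ {σs} → All Term σs → ℕ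
    sizes []       = 0
    sizes (t ∷ ts) = size t + sizes ts

  WellDefined : Set
  WellDefined = ∀ σ → Term σ

  TermOfSize : ℕ → Sort 𝔸 → Set
  TermOfSize b σ = Σ[ t ∈ Term σ ] size t ≡ b

  ExpandingSort : Sort 𝔸 → Set
  ExpandingSort σ = ∀ n → ∃[ b ] ∀ b′ → b ≤ b′ →
    (¬ TermOfSize b′ σ) ⊎ AtLeast n (TermOfSize b′ σ)

  Expanding : Set
  Expanding = ∀ σ → ExpandingSort σ

  𝕊 : Sort 𝔸 → Pred ℕ 0ℓ
  𝕊 σ s = Σ[ t ∈ Term σ ] size t ≡ s

  𝕊-avoiding : Ctor 𝔸 → Sort 𝔸 → Pred ℕ 0ℓ
  𝕊-avoiding f σ s = Σ[ t ∈ Term σ ] headSymbol t ≢ f × size t ≡ s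

  Vertex : Set
  Vertex = Sort 𝔸 ⊎ Ctor 𝔸

  -- An edge is determined by its endpoints: `arg` may have several proofs when
  -- a sort occurs repeatedly in `dom f`, so walks below are vertex sequences.
  data _⟶_ : Vertex → Vertex → Set where
    out : ∀ f → inj₁ (cod f) ⟶ inj₂ f
    arg : ∀ {f σ} → σ ∈ˡ dom f → inj₂ f ⟶ inj₁ σ

  -- The cycle v₀ → v₁ → ⋯ → vₗ → v₀ is given by the list v₀ ∷ v₁ ∷ ⋯ ∷ vₗ ∷ [],
  -- without repeating v₀ at the end.
  IsCycleFrom : Vertex → List Vertex → Set
  IsCycleFrom v vs = head vs ≡ just v × Linked _⟶_ (vs ∷ʳ v)

  IsSimpleCycleFrom : Vertex → List Vertex → Set
  IsSimpleCycleFrom v vs = IsCycleFrom v vs × Unique vs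

  IsOnlyCycleFrom : Vertex → List Vertex → Set
  IsOnlyCycleFrom v vs =
    ∀ ws → IsCycleFrom v ws → ∃[ r ] ws ≡ concat (replicate r vs)

  Unary : Ctor 𝔸 → Set
  Unary f = length (dom f) ≡ 1

  -- (σ¹ , f¹) ∷ ⋯ ∷ (σⁿ , fⁿ) ∷ [] stands for σ¹ → f¹ → ⋯ → σⁿ → fⁿ (→ σ¹).
  Steps : ℕ → Set
  Steps n = Vec (Sort 𝔸 × Ctor 𝔸) n

  vertices : ∀ {n} → Steps n → List Vertex
  vertices []            = []
  vertices ((σ , f) ∷ C) = inj₁ σ ∷ inj₂ f ∷ vertices C

  sortAt : ∀ {n} → Steps n → Fin n → Sort 𝔸
  sortAt C i = proj₁ (lookup C i)

  ctorAt : ∀ {n} → Steps n → Fin n → Ctor 𝔸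
  ctorAt C i = proj₂ (lookup C i)

  -- Positions on the cycle are counted from 0, so `toℕ i` is the offset "i − 1".
  UnboundedlyContributes : ∀ {n} → Steps n → Sort 𝔸 → Set
  UnboundedlyContributes {n} C σ = ∀ k →
    ¬ (𝕊 σ ≐ [0⋯ k ] · n ⊕ ⋃ (Fin n) (λ i → 𝕊-avoiding (ctorAt C i) (sortAt C i) ⊕ˢ toℕ i))

{-# OPTIONS --safe #-}

-- Terms are pumped through one-hole contexts.  In a large term the pigeonhole principle yields, for
-- any Q, a loop context K from some sort τ to itself whose weight is a positive multiple of Q, so
-- it suffices to find many terms of the size of K[y] for each τ, given Q sufficiently divisible.
-- If two loops d, e at τ satisfy d[x] ≠ e[y] for all x and y, then powers D, E of d, e have equal
-- weight, and the contexts Dⁱ Eʲ with i + j fixed do the job.  Such loops exist as soon as some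
-- constructor on a cycle through τ is not unary or some sort on such a cycle has two constructors
-- leading back to τ.  Otherwise the cycle through τ is unique and unary, of some length n, and
-- S_τ = ℕ n + A, where A collects the terms leaving the cycle.  By pumping A is ultimately
-- periodic, so either every residue class mod n that meets A meets it with bounded gaps, and then
-- large terms of τ can be traded for terms with a large subterm of a strictly lower sort; or some
-- class meets A in a nonempty finite set, and then the number of terms with size in that class
-- is eventually constant.
module Submission where

import Algebra.Properties.CommutativeSemigroup as CommutativeSemigroup
open import Data.Fin as Fin using (Fin; zero; suc; toℕ; combine)
import Data.Fin.Properties as Fin
open import Data.Fin.Subset as Subset using (_⊂_; ⊤)
open import Data.Fin.Subset.Induction using (⊂-wellFounded)
open import Data.Fin.Subset.Properties using (∈⊤; x∈p⇒p-x⊂p; x∈p∧x≢y⇒x∈p-y)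
open import Data.List using (List; []; _∷_; _∷ʳ_; _++_; length; lookup; map; concat; concatMap;
  replicate; allFin; cartesianProductWith)
import Data.List.Membership.DecPropositional as DecMembership
open import Data.List.Membership.Propositional using (find; lose) renaming (_∈_ to _∈ˡ_)
open import Data.List.Membership.Propositional.Properties
  using (∈-lookup; ∈-allFin; ∈-concatMap⁺; ∈-map⁺; ∈-cartesianProductWith⁺)
open import Data.List.Relation.Unary.All as All using (All; []; _∷_; _[_]≔_)
open import Data.List.Relation.Unary.All.Properties
  using (lookup∘updateAt; updateAt-id-local; ¬Any⇒All¬)
open import Data.List.Relation.Unary.AllPairs using ([]; _∷_)
open import Data.List.Relation.Unary.Any as Any using (Any; here; there)
open import Data.List.Relation.Unary.Any.Properties using (lookup-index)
open import Data.List.Relation.Unary.Linked using (Linked; [-]; _∷_)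
open import Data.List.Relation.Unary.Unique.Propositional using (Unique)
open import Data.Nat
open import Data.Nat.DivMod using (_mod_; _%_; _/_; m≡m%n+[m/n]*n; m%n<n)
open import Data.Nat.Divisibility
  using (_∣_; divides; ∣-trans; ∣⇒≤; ∣m+n∣m⇒∣n; ∣m⇒∣m*n; ∣n⇒∣m*n; m∣m*n; n∣m*n)
open import Data.Nat.Properties
open import Data.Product using (Σ-syntax; ∃-syntax; ∃; _×_; _,_; proj₁; proj₂)
open import Data.Sum using (_⊎_; inj₁; inj₂; [_,_]′)
open import Data.Vec using ([]; _∷_)
open import Function using (_∘_; mk↣; mk⇔; Injection; case_of_)
open import Function.Bundles using (_⇔_; _↣_)
open import Induction.WellFounded using (Acc; acc)
open import Level using (0ℓ)
open import Relation.Binary.PropositionalEquality hiding ([_])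
open import Relation.Nullary using (¬_; Dec; yes; no; ¬?; contradiction)
open import Relation.Nullary.Decidable using (map′; _×-dec_; _⊎-dec_; decidable-stable)
open import Relation.Unary using (Pred; ⋃; _≐_)
open import Defs

open CommutativeSemigroup +-commutativeSemigroup using (x∙yz≈y∙xz)

-- Finite index sets, divisibility and cardinality bounds.

lookup-injective : ∀ {A : Set} {xs : List A} → Unique xs → ∀ {i j} →
  lookup xs i ≡ lookup xs j → i ≡ j
lookup-injective (_ ∷ _)  {zero}  {zero}  _  = refl
lookup-injective (x≢ ∷ _) {zero}  {suc j} eq = contradiction eq (All.lookup x≢ (∈-lookup j))
lookup-injective (x≢ ∷ _) {suc i} {zero}  eq = contradiction (sym eq) (All.lookup x≢ (∈-lookup i))
lookup-injective (_ ∷ u)  {suc i} {suc j} eq = cong suc (lookup-injective u eq)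

finite-bound : ∀ {n} {Q : Fin n → ℕ → Set} → (∀ {i b c} → b ≤ c → Q i b → Q i c) →
  (∀ i → ∃[ b ] Q i b) → ∃[ b ] ∀ i → Q i b
finite-bound {zero}  _    _ = 0 , λ ()
finite-bound {suc n} mono h with h zero | finite-bound mono (h ∘ suc)
... | b , q | c , qs = b ⊔ c , λ
  { zero    → mono (m≤m⊔n b c) q
  ; (suc i) → mono (m≤n⊔m b c) (qs i) }

common-multiple : ∀ {n} (g : Fin n → ℕ) → (∀ i → 0 < g i) → ∃[ m ] 0 < m × ∀ i → g i ∣ m
common-multiple {zero}  g _   = 1 , s≤s z≤n , λ ()
common-multiple {suc n} g pos with common-multiple (g ∘ suc) (pos ∘ suc)
... | m , m>0 , g∣m = g zero * m , *-mono-< (pos zero) m>0 , λ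
  { zero    → m∣m*n m
  ; (suc i) → ∣n⇒∣m*n (g zero) (g∣m i) }

finite-choice : ∀ {n} {A : Set} {B : Fin n → Set} → (∀ i → A ⊎ B i) → A ⊎ (∀ i → B i)
finite-choice {zero}  _ = inj₂ λ ()
finite-choice {suc n} h with h zero | finite-choice (h ∘ suc)
... | inj₁ a | _       = inj₁ a
... | inj₂ _ | inj₁ a  = inj₁ a
... | inj₂ b | inj₂ bs = inj₂ λ { zero → b ; (suc i) → bs i }

%≡⇒∣ : ∀ {Q w x y} .{{_ : NonZero Q}} → w + y ≡ x → x % Q ≡ y % Q → Q ∣ w
%≡⇒∣ {Q} {w} {x} {y} w+y≡x eq = ∣m+n∣m⇒∣n (divides (x / Q) lemma) (n∣m*n (y / Q))
  where
  open ≡-Reasoning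
  lemma : y / Q * Q + w ≡ x / Q * Q
  lemma = +-cancelˡ-≡ (y % Q) _ _ (begin
    y % Q + (y / Q * Q + w)  ≡⟨ +-assoc (y % Q) _ w ⟨
    y % Q + y / Q * Q + w    ≡⟨ cong (_+ w) (m≡m%n+[m/n]*n y Q) ⟨
    y + w                    ≡⟨ +-comm y w ⟩
    w + y                    ≡⟨ w+y≡x ⟩
    x                        ≡⟨ m≡m%n+[m/n]*n x Q ⟩
    x % Q + x / Q * Q        ≡⟨ cong (_+ x / Q * Q) eq ⟩
    y % Q + x / Q * Q        ∎)

AtLeast-↣ : ∀ {n} {X Y : Set} → X ↣ Y → AtLeast n X → AtLeast n Y
AtLeast-↣ f g = mk↣ (Injection.injective g ∘ Injection.injective f)

AtLeast-≤ : ∀ {m n} {X : Set} → m ≤ n → AtLeast n X → AtLeast m X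
AtLeast-≤ m≤n g = mk↣ {to = λ i → Injection.to g (Fin.inject≤ i m≤n)}
  (Fin.inject≤-injective m≤n m≤n _ _ ∘ Injection.injective g)

module Terms (𝔸 : ADT) where
  open ADT 𝔸 using (#sorts; #ctors; dom; cod)

  𝕋 : Sort 𝔸 → Set
  𝕋 = Term 𝔸

  ∥_∥ : ∀ {σ} → 𝕋 σ → ℕ
  ∥_∥ = size 𝔸

  variable
    ρ σ τ : Sort 𝔸
    xs    : List (Sort 𝔸)

  TermOfSize-≡ : ∀ {b} {t u : TermOfSize 𝔸 b σ} → proj₁ t ≡ proj₁ u → t ≡ u
  TermOfSize-≡ {t = t , p} {_ , q} refl = cong (t ,_) (≡-irrelevant p q)

  -- Enumeration of small terms.

  constructed : ∀ f σ → List (All 𝕋 (dom f)) → List (𝕋 σ)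
  constructed f σ tss with cod f Fin.≟ σ
  ... | yes refl = map (con f) tss
  ... | no _     = []

  ∈-constructed : ∀ f {ts tss} → ts ∈ˡ tss → con f ts ∈ˡ constructed f (cod f) tss
  ∈-constructed f ts∈ with cod f Fin.≟ cod f
  ... | yes refl = ∈-map⁺ (con f) ts∈
  ... | no ≢     = contradiction refl ≢

  mutual
    -- The bound is on depth: all terms of depth at most `k` are listed, among them all terms of
    -- size at most `k`. This keeps the recursion structural.
    terms≤ : ℕ → ∀ σ → List (𝕋 σ)
    terms≤ zero    σ = []
    terms≤ (suc k) σ = concatMap (λ f → constructed f σ (args≤ k (dom f))) (allFin #ctors)

    args≤ : ℕ → ∀ σs → List (All 𝕋 σs)
    args≤ k []       = [] ∷ []
    args≤ k (σ ∷ σs) = cartesianProductWith _∷_ (terms≤ k σ) (args≤ k σs)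

  mutual
    ∈-terms≤ : ∀ {k} (t : 𝕋 σ) → ∥ t ∥ ≤ k → t ∈ˡ terms≤ k σ
    ∈-terms≤ (con f ts) (s≤s ts≤k) = ∈-concatMap⁺ _ {xs = allFin #ctors}
      (lose (∈-allFin f) (∈-constructed f (∈-args≤ ts ts≤k)))

    ∈-args≤ : ∀ {k} (ts : All 𝕋 xs) → sizes 𝔸 ts ≤ k → ts ∈ˡ args≤ k xs
    ∈-args≤ []       _ = here refl
    ∈-args≤ (t ∷ ts) h = ∈-cartesianProductWith⁺ _∷_
      (∈-terms≤ t (m+n≤o⇒m≤o ∥ t ∥ h)) (∈-args≤ ts (m+n≤o⇒n≤o ∥ t ∥ h))

  any-term? : ∀ {P : 𝕋 σ → Set} k → (∀ t → Dec (P t)) → (∀ t → P t → ∥ t ∥ ≤ k) → Dec (∃ P)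
  any-term? {σ = σ} k P? bound = map′ (λ a → let t , _ , pt = find a in t , pt)
    (λ (t , pt) → lose (∈-terms≤ t (bound t pt)) pt) (Any.any? P? (terms≤ k σ))

  TermOfSize? : ∀ b σ → Dec (TermOfSize 𝔸 b σ)
  TermOfSize? b σ = any-term? b (λ t → ∥ t ∥ ≟ b) (λ _ → ≤-reflexive)

  𝕊-avoiding? : ∀ f σ s → Dec (𝕊-avoiding 𝔸 f σ s)
  𝕊-avoiding? f σ s = any-term? s
    (λ t → ¬? (headSymbol 𝔸 t Fin.≟ f) ×-dec (∥ t ∥ ≟ s)) (λ _ → ≤-reflexive ∘ proj₂)

  TermOfSize-finite : ∀ b σ → ∃[ n ] ¬ AtLeast n (TermOfSize 𝔸 b σ)
  TermOfSize-finite b σ = suc (length ts) , λ g →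
    let open Injection g using (to; injective)
        idx = λ i → Any.index (mem (to i))
        i , j , i<j , eq = Fin.pigeonhole ≤-refl idx
    in Fin.<⇒≢ i<j (injective (TermOfSize-≡ (begin
         proj₁ (to i)              ≡⟨ lookup-index (mem (to i)) ⟩
         lookup ts (idx i)  ≡⟨ cong (lookup ts) eq ⟩
         lookup ts (idx j)  ≡⟨ lookup-index (mem (to j)) ⟨
         proj₁ (to j)              ∎)))
    where
    open ≡-Reasoning
    ts = terms≤ b σ
    mem : (t : TermOfSize 𝔸 b σ) → proj₁ t ∈ˡ ts
    mem (t , eq) = ∈-terms≤ t (≤-reflexive eq)

  -- One-hole contexts.

  rest : σ ∈ˡ xs → All 𝕋 xs → ℕ
  rest (here _)  (t ∷ ts) = sizes 𝔸 ts
  rest (there p) (t ∷ ts) = ∥ t ∥ + rest p ts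

  sizes-≔ : (ts : All 𝕋 xs) (p : σ ∈ˡ xs) (u : 𝕋 σ) → sizes 𝔸 (ts [ p ]≔ u) ≡ rest p ts + ∥ u ∥
  sizes-≔ (t ∷ ts) (here refl) u = +-comm ∥ u ∥ _
  sizes-≔ (t ∷ ts) (there p)   u = trans (cong (∥ t ∥ +_) (sizes-≔ ts p u)) (sym (+-assoc ∥ t ∥ _ _))

  con-injective : ∀ {f} {ts us : All 𝕋 (dom f)} → con f ts ≡ con f us → ts ≡ us
  con-injective refl = refl

  -- As every sort is inhabited, Ctx ρ σ also serves as the proposition that σ reaches ρ in the
  -- dependency graph.
  data Ctx (ρ : Sort 𝔸) : Sort 𝔸 → Set where
    □     : Ctx ρ ρ
    frame : ∀ f → σ ∈ˡ dom f → All 𝕋 (dom f) → Ctx ρ σ → Ctx ρ (cod f)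

  fill : Ctx ρ σ → 𝕋 ρ → 𝕋 σ
  fill □                t = t
  fill (frame f p ts K) t = con f (ts [ p ]≔ fill K t)

  weight : Ctx ρ σ → ℕ
  weight □                = 0
  weight (frame f p ts K) = suc (rest p ts + weight K)

  size-fill : (K : Ctx ρ σ) (t : 𝕋 ρ) → ∥ fill K t ∥ ≡ weight K + ∥ t ∥
  size-fill □                t = refl
  size-fill (frame f p ts K) t = cong suc (begin
    sizes 𝔸 (ts [ p ]≔ fill K t)   ≡⟨ sizes-≔ ts p _ ⟩
    rest p ts + ∥ fill K t ∥       ≡⟨ cong (rest p ts +_) (size-fill K t) ⟩
    rest p ts + (weight K + ∥ t ∥) ≡⟨ +-assoc (rest p ts) _ _ ⟨
    rest p ts + weight K + ∥ t ∥   ∎)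
    where open ≡-Reasoning

  fill-injective : (K : Ctx ρ σ) {t u : 𝕋 ρ} → fill K t ≡ fill K u → t ≡ u
  fill-injective □                eq = eq
  fill-injective (frame f p ts K) eq = fill-injective K (begin
    fill K _                              ≡⟨ lookup∘updateAt ts p ⟨
    All.lookup (ts [ p ]≔ fill K _) p     ≡⟨ cong (λ us → All.lookup us p) (con-injective eq) ⟩
    All.lookup (ts [ p ]≔ fill K _) p     ≡⟨ lookup∘updateAt ts p ⟩
    fill K _                              ∎)
    where open ≡-Reasoning

  infixr 9 _⊚_
  _⊚_ : Ctx ρ σ → Ctx τ ρ → Ctx τ σ
  □              ⊚ L = L
  frame f p ts K ⊚ L = frame f p ts (K ⊚ L)

  fill-⊚ : (K : Ctx ρ σ) (L : Ctx τ ρ) (t : 𝕋 τ) → fill (K ⊚ L) t ≡ fill K (fill L t)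
  fill-⊚ □                L t = refl
  fill-⊚ (frame f p ts K) L t = cong (λ u → con f (ts [ p ]≔ u)) (fill-⊚ K L t)

  weight-⊚ : (K : Ctx ρ σ) (L : Ctx τ ρ) → weight (K ⊚ L) ≡ weight K + weight L
  weight-⊚ □                L = refl
  weight-⊚ (frame f p ts K) L = cong suc
    (trans (cong (rest p ts +_) (weight-⊚ K L)) (sym (+-assoc (rest p ts) _ _)))

  infixr 10 _^ᶜ_
  _^ᶜ_ : Ctx σ σ → ℕ → Ctx σ σ
  K ^ᶜ zero  = □
  K ^ᶜ suc n = K ⊚ K ^ᶜ n

  weight-^ᶜ : (K : Ctx σ σ) (n : ℕ) → weight (K ^ᶜ n) ≡ n * weight K
  weight-^ᶜ K zero    = refl
  weight-^ᶜ K (suc n) = trans (weight-⊚ K (K ^ᶜ n)) (cong (weight K +_) (weight-^ᶜ K n))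

  AtLeast-fill : ∀ {n s} (K : Ctx ρ σ) → AtLeast n (TermOfSize 𝔸 s ρ) →
    AtLeast n (TermOfSize 𝔸 (weight K + s) σ)
  AtLeast-fill K = AtLeast-↣ (mk↣
    {to = λ (t , eq) → fill K t , trans (size-fill K t) (cong (weight K +_) eq)}
    (TermOfSize-≡ ∘ fill-injective K ∘ cong proj₁))

  -- Long branches and pumping.

  big-arg : ∀ {b} (ts : All 𝕋 xs) → length xs * b < sizes 𝔸 ts →
    ∃[ ρ ] Σ[ p ∈ ρ ∈ˡ xs ] b < ∥ All.lookup ts p ∥
  big-arg {b = b} (t ∷ ts) h with b <? ∥ t ∥
  ... | yes b<t = _ , here refl , b<t
  ... | no  b≮t with big-arg ts (+-cancelˡ-< b _ _ (<-≤-trans h (+-monoˡ-≤ _ (≮⇒≥ b≮t))))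
  ...   | ρ , p , b<u = ρ , there p , b<u

  arity-bound : ∃[ M ] ∀ f → length (dom f) ≤ M
  arity-bound = finite-bound (λ b≤c → λ h → ≤-trans h b≤c) (λ f → _ , ≤-refl)

  big-arg-of : ∀ b f (ts : All 𝕋 (dom f)) → proj₁ arity-bound * b < sizes 𝔸 ts →
    ∃[ ρ ] Σ[ p ∈ ρ ∈ˡ dom f ] b < ∥ All.lookup ts p ∥
  big-arg-of b f ts h = big-arg ts (≤-<-trans (*-monoˡ-≤ b (proj₂ arity-bound f)) h)

  data Path : ℕ → 𝕋 σ → Set where
    []  : {t : 𝕋 σ} → Path 0 t
    _∷_ : ∀ {l f} {ts : All 𝕋 (dom f)} (p : σ ∈ˡ dom f) → Path l (All.lookup ts p) →
      Path (suc l) (con f ts)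

  -- Arities are bounded, so a large enough term has an argument that is itself large; repeating the
  -- choice `l` times gives the branch.
  long-path : ∀ l → ∃[ b ] ∀ {σ} (t : 𝕋 σ) → b < ∥ t ∥ → Path l t
  long-path zero    = 0 , λ _ _ → []
  long-path (suc l) with long-path l
  ... | b , path = suc (proj₁ arity-bound * b) , λ
    { (con f ts) (s≤s h) → let _ , p , big = big-arg-of b f ts h in p ∷ path _ big }

  node : ∀ {l} {t : 𝕋 σ} → Path l t → Fin (suc l) → ∃ 𝕋
  node {t = t} _       zero    = _ , t
  node         (p ∷ π) (suc i) = node π i

  above : ∀ {l} {t : 𝕋 σ} (π : Path l t) i →
    Σ[ K ∈ Ctx (proj₁ (node π i)) σ ] fill K (proj₂ (node π i)) ≡ t
  above π zero = □ , refl
  above (_∷_ {f = f} {ts} p π) (suc i) with above π i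
  ... | K , eq = frame f p ts K ,
    cong (con f) (trans (cong (ts [ p ]≔_) eq) (updateAt-id-local p ts refl))

  between : ∀ {l} {t : 𝕋 σ} (π : Path l t) {i j} → i Fin.< j →
    Σ[ K ∈ Ctx (proj₁ (node π j)) (proj₁ (node π i)) ]
      fill K (proj₂ (node π j)) ≡ proj₂ (node π i) × 0 < weight K
  between (_∷_ {f = f} {ts} p π) {zero} {suc j} _ with above π j
  ... | K , eq = frame f p ts K ,
    cong (con f) (trans (cong (ts [ p ]≔_) eq) (updateAt-id-local p ts refl)) , s≤s z≤n
  between (p ∷ π) {suc i} {suc j} (s≤s i<j) = between π i<j

  record Pumped (Q : ℕ) (t : 𝕋 σ) : Set where
    field
      {loopSort}  : Sort 𝔸
      outer       : Ctx loopSort σ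
      inner       : Ctx loopSort loopSort
      core        : 𝕋 loopSort
      splits      : t ≡ fill outer (fill inner core)
      c           : ℕ
      weight-loop : weight inner ≡ suc c * Q

  -- Two nested subterms of equal sort whose sizes agree modulo Q.
  pump : ∀ Q → 0 < Q → ∃[ b ] ∀ {σ} (t : 𝕋 σ) → b < ∥ t ∥ → Pumped Q t
  pump Q@(suc _) _ = proj₁ (long-path (#sorts * Q)) , λ t h → pumped (proj₂ (long-path (#sorts * Q)) t h)
    where
    colour : ∃ 𝕋 → Fin (#sorts * Q)
    colour (σ , t) = combine σ (∥ t ∥ mod Q)

    toℕ-mod : ∀ m → toℕ (m mod Q) ≡ m % Q
    toℕ-mod m = Fin.toℕ-fromℕ< (m%n<n m Q)

    assemble : ∀ {σ} {t : 𝕋 σ} ((ρ , x) (ρ′ , y) : ∃ 𝕋) → colour (ρ , x) ≡ colour (ρ′ , y) →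
      Σ[ G ∈ Ctx ρ σ ] fill G x ≡ t →
      Σ[ K ∈ Ctx ρ′ ρ ] fill K y ≡ x × 0 < weight K → Pumped Q t
    assemble (ρ , x) (ρ′ , y) eq (G , G≡) (K , K≡ , K>0)
      with Fin.combine-injective ρ (∥ x ∥ mod Q) ρ′ (∥ y ∥ mod Q) eq
    ... | refl , eq%
      with %≡⇒∣ {Q} (trans (sym (size-fill K y)) (cong ∥_∥ K≡))
             (trans (sym (toℕ-mod ∥ x ∥)) (trans (cong toℕ eq%) (toℕ-mod ∥ y ∥)))
    ... | divides zero    w≡0 = contradiction (subst (0 <_) w≡0 K>0) λ ()
    ... | divides (suc c) w≡  = record
      { outer = G ; inner = K ; core = y ; c = c ; weight-loop = w≡
      ; splits = trans (sym G≡) (cong (fill G) (sym K≡)) }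

    pumped : ∀ {σ} {t : 𝕋 σ} → Path (#sorts * Q) t → Pumped Q t
    -- The branch has `#sorts * Q + 1` nodes, one more than there are pairs of a sort and a residue.
    pumped π with Fin.pigeonhole (n<1+n _) (colour ∘ node π)
    ... | i , j , i<j , eq = assemble (node π i) (node π j) eq (above π i) (between π i<j)

module Graph (𝔸 : ADT) (wd : WellDefined 𝔸) where
  open ADT 𝔸 using (#sorts; #ctors; dom; cod)
  open Terms 𝔸
  open DecMembership (Fin._≟_ {#sorts}) using (_∈?_)

  variable
    n : ℕ
    C : Steps 𝔸 n

  -- Simple paths and decidable reachability.

  defaults : All 𝕋 xs
  defaults = All.universal wd _

  inits : Ctx τ σ → List (Sort 𝔸)
  inits □                = []
  inits (frame f _ _ K) = cod f ∷ inits K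

  -- The sort of the hole is included so that a constructor of codomain `τ` that closes a simple `K`
  -- to a loop yields a simple cycle.
  Simple : Ctx τ σ → Set
  Simple {τ} K = Unique (τ ∷ inits K)

  suffix : (K : Ctx τ σ) → ρ ∈ˡ inits K → Simple K → Σ[ L ∈ Ctx τ ρ ] Simple L
  suffix K@(frame _ _ _ _) (here refl) u                        = K , u
  suffix (frame _ _ _ K)   (there m)   ((_ ∷ τ∉) ∷ (_ ∷ u)) = suffix K m (τ∉ ∷ u)

  simplify : Ctx τ σ → Σ[ K ∈ Ctx τ σ ] Simple K
  simplify □ = □ , [] ∷ []
  simplify {τ = τ} (frame f p ts K) with simplify K
  ... | L , s@(τ∉ ∷ u) with cod f Fin.≟ τ | cod f ∈? inits L
  ...   | yes refl | _     = □ , [] ∷ []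
  ...   | no _     | yes m = suffix L m s
  ...   | no f≢τ   | no f∉ = frame f p ts L , ((f≢τ ∘ sym) ∷ τ∉) ∷ ¬Any⇒All¬ _ f∉ ∷ u

  Within : ℕ → Sort 𝔸 → Sort 𝔸 → Set
  Within k τ σ = Σ[ K ∈ Ctx τ σ ] length (inits K) ≤ k

  within-frame : ∀ {k} f → Any (Within k τ) (dom f) → Within (suc k) τ (cod f)
  within-frame f a with find a
  ... | _ , p , K , K≤k = frame f p defaults K , s≤s K≤k

  within? : ∀ k τ σ → Dec (Within k τ σ)
  within? zero τ σ = map′ (λ { refl → □ , z≤n }) (λ { (□ , _) → refl }) (σ Fin.≟ τ)
  within? (suc k) τ σ = map′
    (λ { (inj₁ refl) → □ , z≤n ; (inj₂ (f , refl , a)) → within-frame f a })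
    (λ { (□ , _)                   → inj₁ refl
       ; (frame f p _ K , s≤s K≤k) → inj₂ (f , refl , lose p (K , K≤k)) })
    ((σ Fin.≟ τ) ⊎-dec Fin.any? λ f → (cod f Fin.≟ σ) ×-dec Any.any? (within? k τ) (dom f))

  shorten : Ctx τ σ → Within #sorts τ σ
  shorten K with simplify K
  ... | L , _ ∷ u = L , Fin.injective⇒≤ (lookup-injective u)

  -- A path can be cut down to a simple one, which visits each sort at most once, so a search of
  -- depth `#sorts` is exhaustive.
  reaches? : ∀ τ σ → Dec (Ctx τ σ)
  reaches? τ σ = map′ proj₁ shorten (within? #sorts τ σ)

  -- Cycles and resizing of terms.

  Returns : Sort 𝔸 → Ctor 𝔸 → Set
  Returns τ f = Any (Ctx τ) (dom f)

  returns? : ∀ τ f → Dec (Returns τ f)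
  returns? τ f = Any.any? (reaches? τ) (dom f)

  Cyclic : Sort 𝔸 → Set
  Cyclic τ = ∃[ f ] cod f ≡ τ × Returns τ f

  cyclic? : ∀ τ → Dec (Cyclic τ)
  cyclic? τ = Fin.any? λ f → (cod f Fin.≟ τ) ×-dec returns? τ f

  cyclic : (K : Ctx τ τ) → 0 < weight K → Cyclic τ
  cyclic (frame f p _ K) _ = f , refl , lose p K

  -- Fixes one positive loop weight per sort, with the dummy value `1` off the cycles, so that a
  -- common multiple over all sorts can be formed.
  loop-weight : ∀ τ → ∃[ w ] 0 < w × (Cyclic τ → Σ[ K ∈ Ctx τ τ ] weight K ≡ w)
  loop-weight τ with cyclic? τ
  ... | no ¬c = 1 , s≤s z≤n , λ c → contradiction c ¬c
  ... | yes (f , refl , a) with find a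
  ...   | _ , p , K = _ , s≤s z≤n , λ _ → frame f p defaults K , refl

  record Resizable (Q : ℕ) (t : 𝕋 σ) : Set where
    constructor resizable
    field
      {grown shrunk} : 𝕋 σ
      ∥grown∥        : ∥ grown ∥ ≡ Q + ∥ t ∥
      ∥shrunk∥       : Q + ∥ shrunk ∥ ≡ ∥ t ∥

  -- Pumping yields a loop of weight `suc c * Q`. Deleting it could remove more than `Q`, so it is
  -- exchanged for a loop of weight `(c + 2) * Q` or `c * Q` at the same sort. Both exist as powers
  -- of a fixed loop, because `Q` is a multiple of every chosen loop weight.
  resize : ∀ n → 0 < n → ∃[ m ] 0 < m × ∃[ b ] ∀ {σ} (t : 𝕋 σ) → b < ∥ t ∥ → Resizable (m * n) t
  resize n n>0 with common-multiple (proj₁ ∘ loop-weight) (proj₁ ∘ proj₂ ∘ loop-weight)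
  ... | m , m>0 , w∣m = m , m>0 , proj₁ pump-Q , λ t h → go (proj₂ pump-Q t h)
    where
    Q = m * n
    pump-Q = pump Q (*-mono-< m>0 n>0)

    loop : Cyclic τ → ∀ c → Σ[ K ∈ Ctx τ τ ] weight K ≡ c * Q
    loop {τ} cyc c with loop-weight τ | ∣n⇒∣m*n c (∣m⇒∣m*n n (w∣m τ))
    ... | w , _ , mk | divides q eq with mk cyc
    ... | K , refl = K ^ᶜ q , trans (weight-^ᶜ K q) (sym eq)

    go : {t : 𝕋 σ} → Pumped Q t → Resizable Q t
    go record { outer = G ; inner = K ; core = y ; splits = refl ; c = c ; weight-loop = eq }
      with cyc ← cyclic K (subst (0 <_) (sym eq) (<-≤-trans (*-mono-< m>0 n>0) (m≤m+n Q (c * Q))))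
      with loop cyc (suc (suc c)) | loop cyc c
    ... | K⁺ , eq⁺ | K⁻ , eq⁻ = resizable (grow G K⁺ K y (trans eq⁺ (cong (Q +_) (sym eq))))
                                         (sym (grow G K K⁻ y (trans eq (cong (Q +_) (sym eq⁻)))))
      where
      open ≡-Reasoning
      grow : (G : Ctx τ σ) (K L : Ctx τ τ) (y : 𝕋 τ) → weight K ≡ Q + weight L →
        ∥ fill G (fill K y) ∥ ≡ Q + ∥ fill G (fill L y) ∥
      grow G K L y w≡ = begin
        ∥ fill G (fill K y) ∥                 ≡⟨ size-fill G _ ⟩
        weight G + ∥ fill K y ∥               ≡⟨ cong (weight G +_) (size-fill K y) ⟩
        weight G + (weight K + ∥ y ∥)         ≡⟨ cong (λ w → weight G + (w + ∥ y ∥)) w≡ ⟩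
        weight G + (Q + weight L + ∥ y ∥)     ≡⟨ cong (weight G +_) (+-assoc Q _ _) ⟩
        weight G + (Q + (weight L + ∥ y ∥))   ≡⟨ cong (λ s → weight G + (Q + s)) (size-fill L y) ⟨
        weight G + (Q + ∥ fill L y ∥)         ≡⟨ x∙yz≈y∙xz (weight G) Q _ ⟩
        Q + (weight G + ∥ fill L y ∥)         ≡⟨ cong (Q +_) (size-fill G _) ⟨
        Q + ∥ fill G (fill L y) ∥             ∎

  sizes-lookup : (ts : All 𝕋 xs) (p : σ ∈ˡ xs) → sizes 𝔸 ts ≡ rest p ts + ∥ All.lookup ts p ∥
  sizes-lookup ts p = trans (cong (sizes 𝔸) (sym (updateAt-id-local p ts refl))) (sizes-≔ ts p _)

  -- Only a large proper argument is resized, so the head symbol survives.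
  resize-avoiding : ∀ n → 0 < n → ∃[ m ] 0 < m × ∃[ b ] ∀ {f σ s} → b < s → 𝕊-avoiding 𝔸 f σ s →
    𝕊-avoiding 𝔸 f σ (m * n + s) × ∃[ r ] m * n + r ≡ s × 𝕊-avoiding 𝔸 f σ r
  resize-avoiding n n>0 with resize n n>0
  ... | m , m>0 , b , rs = m , m>0 , suc (proj₁ arity-bound * b) , go
    where
    Q = m * n
    shift : ∀ r {x y} → x ≡ Q + y → suc (r + x) ≡ Q + suc (r + y)
    shift r refl = trans (cong suc (x∙yz≈y∙xz r Q _)) (sym (+-suc Q _))

    go : ∀ {f σ s} → suc (proj₁ arity-bound * b) < s → 𝕊-avoiding 𝔸 f σ s →
      𝕊-avoiding 𝔸 f σ (Q + s) × ∃[ r ] Q + r ≡ s × 𝕊-avoiding 𝔸 f σ r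
    go (s≤s h) (con g ts , g≢f , refl) with big-arg-of b g ts h
    ... | _ , p , big with rs (All.lookup ts p) big
    ... | resizable {t⁺} {t⁻} eq⁺ eq⁻ =
      (con g (ts [ p ]≔ t⁺) , g≢f , trans (cong suc (sizes-≔ ts p t⁺))
        (trans (shift (rest p ts) eq⁺) (cong (λ s → Q + suc s) (sym (sizes-lookup ts p))))) ,
      suc (rest p ts + ∥ t⁻ ∥) ,
      trans (sym (shift (rest p ts) (sym eq⁻))) (cong suc (sym (sizes-lookup ts p))) ,
      (con g (ts [ p ]≔ t⁻) , g≢f , cong suc (sizes-≔ ts p t⁻))

  -- Unary paths and the sizes of terms leaving them.

  rest-unary : length xs ≡ 1 → (p : σ ∈ˡ xs) (ts : All 𝕋 xs) → rest p ts ≡ 0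
  rest-unary {xs = _ ∷ []} refl (here _) (_ ∷ []) = refl

  ≔-unary : length xs ≡ 1 → (p : σ ∈ˡ xs) (ts us : All 𝕋 xs) → ts [ p ]≔ All.lookup us p ≡ us
  ≔-unary {xs = _ ∷ []} refl (here refl) (_ ∷ []) (_ ∷ []) = refl

  data Spine (τ : Sort 𝔸) : Sort 𝔸 → Steps 𝔸 n → Set where
    []   : Spine τ τ []
    link : ∀ {f} → cod f ≡ σ → ρ ∈ˡ dom f → Unary 𝔸 f → Spine τ ρ C → Spine τ σ ((σ , f) ∷ C)

  toCtx : Spine τ σ C → Ctx τ σ
  toCtx []                           = □
  toCtx (link {f = f} refl p _ sp) = frame f p defaults (toCtx sp)

  weight-toCtx : (sp : Spine τ {n} σ C) → weight (toCtx sp) ≡ n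
  weight-toCtx []                   = refl
  weight-toCtx (link refl p u sp) = cong suc (cong₂ _+_ (rest-unary u p defaults) (weight-toCtx sp))

  -- The set `A` of the overview: sizes of terms that leave the path before its end, where the
  -- offset `toℕ i` counts the unary constructors passed before leaving.
  Exits : Steps 𝔸 n → Pred ℕ 0ℓ
  Exits {n} C = ⋃ (Fin n) (λ i → 𝕊-avoiding 𝔸 (ctorAt 𝔸 C i) (sortAt 𝔸 C i) ⊕ˢ toℕ i)

  exits? : (C : Steps 𝔸 n) → ∀ a → Dec (Exits C a)
  exits? C a = Fin.any? λ i → map′
    (λ (le , s∈) → a ∸ toℕ i , s∈ , sym (m∸n+n≡m le))
    (λ { (s , s∈ , refl) → m≤n+m (toℕ i) s , subst (𝕊-avoiding 𝔸 _ _) (sym (m+n∸n≡m s (toℕ i))) s∈ })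
    ((toℕ i ≤? a) ×-dec 𝕊-avoiding? _ _ (a ∸ toℕ i))

  -- Walk down the term along the spine: the first deviating head symbol gives the exit, and unarity
  -- ensures that nothing but the passed constructors is added to its size.
  peel : (sp : Spine τ σ C) (t : 𝕋 σ) → (∃[ u ] fill (toCtx sp) u ≡ t) ⊎ Exits C ∥ t ∥
  peel [] t = inj₁ (t , refl)
  peel (link {f = f} eq p u sp) (con g ts) with g Fin.≟ f
  ... | no g≢f = inj₂ (zero , _ , (con g ts , g≢f , refl) , sym (+-identityʳ _))
  peel (link refl p u sp) (con g ts) | yes refl with peel sp (All.lookup ts p)
  ... | inj₁ (v , eq) = inj₁ (v , cong (con g) (trans (cong (_ [ p ]≔_) eq) (≔-unary u p _ ts)))
  ... | inj₂ (i , s , s∈ , eq) = inj₂ (suc i , s , s∈ , (begin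
    suc (sizes 𝔸 ts)                             ≡⟨ cong suc (sizes-lookup ts p) ⟩
    suc (rest p ts + ∥ All.lookup ts p ∥)        ≡⟨ cong₂ (λ r q → suc (r + q)) (rest-unary u p ts) eq ⟩
    suc (s + toℕ i)                              ≡⟨ +-suc s (toℕ i) ⟨
    s + suc (toℕ i)                              ∎))
    where open ≡-Reasoning

  record Prefix (τ σ : Sort 𝔸) (C : Steps 𝔸 n) (i : Fin n) : Set where
    field
      ctx     : Ctx (sortAt 𝔸 C i) σ
      offset  : weight ctx ≡ toℕ i
      cod≡    : cod (ctorAt 𝔸 C i) ≡ sortAt 𝔸 C i
      returns : Returns τ (ctorAt 𝔸 C i)

  prefix : Spine τ σ C → ∀ i → Prefix τ σ C i
  prefix (link refl p u sp) zero = record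
    { ctx = □ ; offset = refl ; cod≡ = refl ; returns = lose p (toCtx sp) }
  prefix (link {f = f} refl p u sp) (suc i) = record
    { ctx = frame f p defaults ctx
    ; offset = cong suc (trans (cong (_+ weight ctx) (rest-unary u p defaults)) offset)
    ; cod≡ = cod≡ ; returns = returns }
    where open Prefix (prefix sp i)

  exit-term : Spine τ σ C → ∀ {a} → Exits C a → TermOfSize 𝔸 a σ
  exit-term sp (i , s , (t , _ , refl) , refl) =
    fill ctx t , trans (size-fill ctx t) (trans (cong (_+ ∥ t ∥) offset) (+-comm (toℕ i) ∥ t ∥))
    where open Prefix (prefix sp i)

  -- Exits of a unary cycle modulo its length.

  module Cycle {n} {τ} {C : Steps 𝔸 (suc n)} (sp : Spine τ τ C) where
    private
      N = suc n

    wrap : ∀ j {a} → TermOfSize 𝔸 a τ → TermOfSize 𝔸 (j * N + a) τ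
    wrap j (t , eq) = fill (K ^ᶜ j) t ,
      trans (size-fill (K ^ᶜ j) t)
        (cong₂ _+_ (trans (weight-^ᶜ K j) (cong (j *_) (weight-toCtx sp))) eq)
      where K = toCtx sp

    -- Each full turn removes `N` from the size, so a bound `k` on the size serves as fuel.
    unwrap : ∀ k (t : 𝕋 τ) → ∥ t ∥ ≤ k → ∃[ j ] ∃[ a ] Exits C a × ∥ t ∥ ≡ j * N + a
    unwrap zero    (con _ _) ()
    unwrap (suc k) t h with peel sp t
    ... | inj₂ a∈ = 0 , _ , a∈ , refl
    ... | inj₁ (u , refl) with eq ← trans (size-fill (toCtx sp) u) (cong (_+ ∥ u ∥) (weight-toCtx sp))
          with unwrap k u (≤-trans (m≤n+m _ n) (≤-pred (subst (_≤ suc k) eq h)))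
    ... | j , a , a∈ , eq′ = suc j , a , a∈ , trans eq (trans (cong (N +_) eq′) (sym (+-assoc N (j * N) a)))

    Bounded : ℕ → Set
    Bounded k = 𝕊 𝔸 τ ≐ [0⋯ k ] · N ⊕ Exits C

    -- The residue class of `base` modulo `N` contains an exit, and all its exits lie below `bound`.
    record Sparse : Set where
      field
        {base bound} : ℕ
        base∈        : Exits C base
        bounded      : ∀ j → Exits C (j * N + base) → j * N + base < bound

    -- Exits are ultimately periodic, by resizing the term that leaves the cycle. The extra `N` in
    -- the threshold pays for the offset of the position, which is less than `N`.
    exits-shift : ∃[ m ] 0 < m × ∃[ b ] ∀ {a} → b ≤ a → Exits C a →
      Exits C (m * N + a) × ∃[ r ] m * N + r ≡ a × Exits C r
    exits-shift with resize-avoiding N (s≤s z≤n)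
    ... | m , m>0 , b , shift = m , m>0 , suc b + N , go
      where
      go : ∀ {a} → suc b + N ≤ a → Exits C a →
        Exits C (m * N + a) × ∃[ r ] m * N + r ≡ a × Exits C r
      go h (i , s , s∈ , refl) with shift
        (+-cancelʳ-≤ N _ _ (≤-trans h (+-monoʳ-≤ s (<⇒≤ (Fin.toℕ<n i))))) s∈
      ... | s⁺∈ , r , refl , r∈ =
        (i , m * N + s , s⁺∈ , sym (+-assoc (m * N) s (toℕ i))) ,
        r + toℕ i , sym (+-assoc (m * N) r (toℕ i)) , i , r , r∈ , refl

    -- Periodicity beyond `b` reduces the alternative to a decidable search for a stuck exit below
    -- `b`.
    dichotomy : (∃[ k ] Bounded k) ⊎ Sparse
    dichotomy with exits-shift
    ... | m , m>0 , b , shift = result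
      where
      Late : ℕ → ℕ → Set
      Late a j = Exits C (j * N + a) × b ≤ j * N + a

      late? : ∀ a j → Dec (Late a j)
      late? a j = exits? C _ ×-dec (b ≤? _)

      -- While `j` is at least `b + m`, subtracting `m` leaves an index of at least `b`, so the
      -- shifted exit is still late. The argument `k` is fuel.
      earlier : ∀ a k j → j ≤ k → Late a j → ∃[ i ] i < b + m × Late a i
      earlier a k j j≤k (j∈ , b≤) with j <? b + m
      ... | yes j< = j , j< , j∈ , b≤
      earlier a k       zero    _         _         | no j≮ = contradiction (<-≤-trans m>0 (m≤n+m m b)) j≮
      earlier a (suc k) (suc j) j≤k (j∈ , b≤) | no j≮ with shift b≤ j∈
      ... | _ , r , eq , r∈ = earlier a k (suc j ∸ m)
        (≤-trans (∸-monoʳ-≤ (suc j) m>0) (≤-pred j≤k)) (subst (Exits C) r≡ r∈ , b≤r)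
        where
        open ≡-Reasoning
        b+m≤j : b + m ≤ suc j
        b+m≤j = ≮⇒≥ j≮
        r≡ : r ≡ (suc j ∸ m) * N + a
        r≡ = +-cancelˡ-≡ (m * N) _ _ (begin
          m * N + r                          ≡⟨ eq ⟩
          suc j * N + a                      ≡⟨ cong (λ x → x * N + a) (m+[n∸m]≡n (≤-trans (m≤n+m m b) b+m≤j)) ⟨
          (m + (suc j ∸ m)) * N + a          ≡⟨ cong (_+ a) (*-distribʳ-+ N m _) ⟩
          m * N + (suc j ∸ m) * N + a        ≡⟨ +-assoc (m * N) _ a ⟩
          m * N + ((suc j ∸ m) * N + a)      ∎)
        b≤r : b ≤ (suc j ∸ m) * N + a
        b≤r = ≤-trans (m+n≤o⇒m≤o∸n b b+m≤j) (≤-trans (m≤m*n _ N) (m≤m+n _ a))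

      -- By `earlier`, no late index below `b + m` means no late index at all.
      Stuck : ℕ → Set
      Stuck a = Exits C a × ¬ (∃[ j ] j < b + m × Late a j)

      stuck? : ∀ a → Dec (Stuck a)
      stuck? a = exits? C a ×-dec ¬? (anyUpTo? (late? a) (b + m))

      -- Moves `m` turns at a time from the multiplier into the exit, until at most `m` turns
      -- remain. The argument `k` is fuel.
      absorb : ∀ k j {a} → j ≤ k → b ≤ a → Exits C a → ([0⋯ m ] · N ⊕ Exits C) (j * N + a)
      absorb k j j≤k b≤a a∈ with j ≤? m
      ... | yes j≤m = j * N , _ , (j , j≤m , refl) , a∈ , refl
      absorb k       zero    _         _   _  | no j≰m = contradiction z≤n j≰m
      absorb (suc k) (suc j) {a} j≤k b≤a a∈ | no j≰m = subst ([0⋯ m ] · N ⊕ Exits C) eq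
        (absorb k (suc j ∸ m) (≤-trans (∸-monoʳ-≤ (suc j) m>0) (≤-pred j≤k))
          (≤-trans b≤a (m≤n+m a (m * N))) (proj₁ (shift b≤a a∈)))
        where
        open ≡-Reasoning
        eq : (suc j ∸ m) * N + (m * N + a) ≡ suc j * N + a
        eq = begin
          (suc j ∸ m) * N + (m * N + a)  ≡⟨ +-assoc ((suc j ∸ m) * N) _ a ⟨
          (suc j ∸ m) * N + m * N + a    ≡⟨ cong (_+ a) (*-distribʳ-+ N (suc j ∸ m) m) ⟨
          (suc j ∸ m + m) * N + a        ≡⟨ cong (λ x → x * N + a) (m∸n+n≡m (<⇒≤ (≰⇒> j≰m))) ⟩
          suc j * N + a                  ∎

      widen : ∀ {k l x} → k ≤ l → ([0⋯ k ] · N ⊕ Exits C) x → ([0⋯ l ] · N ⊕ Exits C) x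
      widen k≤l (_ , a , (j , j≤k , eq) , a∈ , eq′) = _ , a , (j , ≤-trans j≤k k≤l , eq) , a∈ , eq′

      result : (∃[ k ] Bounded k) ⊎ Sparse
      result with anyUpTo? stuck? b
      ... | yes (a , a<b , a∈ , none) = inj₂ record
        { base∈ = a∈
        ; bounded = λ j j∈ → ≰⇒> λ b≤ → none (earlier a j j ≤-refl (j∈ , b≤)) }
      ... | no unstuck = inj₁ (b + m , (λ { (t , refl) → cover (unwrap _ t ≤-refl) }) ,
          λ { (_ , _ , (j , _ , refl) , a∈ , refl) → wrap j (exit-term sp a∈) })
        where
        cover : ∀ {s} → ∃[ j ] ∃[ a ] Exits C a × s ≡ j * N + a → ([0⋯ b + m ] · N ⊕ Exits C) s
        cover (j , a , a∈ , refl) with b ≤? a | j ≤? b + m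
        ... | yes b≤a | _        = widen (m≤n+m m b) (absorb j j ≤-refl b≤a a∈)
        ... | no  _   | yes j≤   = j * N , a , (j , j≤ , refl) , a∈ , refl
        -- As `a` is not stuck, its class has a late exit at some index `i` below `b + m`; the turns
        -- beyond `i` are then absorbed from there.
        ... | no  b≰a | no j≰
          with decidable-stable (anyUpTo? (late? a) (b + m)) (λ none → unstuck (a , ≰⇒> b≰a , a∈ , none))
        ... | i , i< , i∈ , b≤i = subst ([0⋯ b + m ] · N ⊕ Exits C) eq
            (widen (m≤n+m m b) (absorb (j ∸ i) (j ∸ i) ≤-refl b≤i i∈))
          where
          open ≡-Reasoning
          eq : (j ∸ i) * N + (i * N + a) ≡ j * N + a
          eq = begin
            (j ∸ i) * N + (i * N + a)  ≡⟨ +-assoc ((j ∸ i) * N) _ a ⟨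
            (j ∸ i) * N + i * N + a    ≡⟨ cong (_+ a) (*-distribʳ-+ N (j ∸ i) i) ⟨
            (j ∸ i + i) * N + a        ≡⟨ cong (λ x → x * N + a) (m∸n+n≡m (<⇒≤ (<-trans i< (≰⇒> j≰)))) ⟩
            j * N + a                  ∎

module Classify (𝔸 : ADT) (wd : WellDefined 𝔸) (two : ∀ σ → AtLeast 2 (Term 𝔸 σ)) where
  open ADT 𝔸 using (#sorts; #ctors; dom; cod)
  open Terms 𝔸
  open Graph 𝔸 wd

  private variable
    ws : List (Vertex 𝔸)

  -- Ambiguous loops.

  record Ambiguous (τ : Sort 𝔸) : Set where
    field
      left right : Ctx τ τ
      clash      : ∀ x y → fill left x ≢ fill right y

  -- left ^ weight right and right ^ weight left have equal weight, so each way to stack c copies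
  -- of them yields a term of the same size.
  module _ (am : Ambiguous τ) where
    open Ambiguous am
    private
      D E : Ctx τ τ
      D = left ^ᶜ weight right
      E = right ^ᶜ weight left

    left-heavy : 0 < weight left
    left-heavy with left | clash
    ... | □             | ≢ = contradiction refl (≢ (fill right (wd τ)) (wd τ))
    ... | frame _ _ _ _ | _ = s≤s z≤n

    right-heavy : 0 < weight right
    right-heavy with right | clash
    ... | □             | ≢ = contradiction refl (≢ (wd τ) (fill left (wd τ)))
    ... | frame _ _ _ _ | _ = s≤s z≤n

    -- Both exponents are positive, so the outermost copies of `left` and `right` already clash.
    powers-clash : ∀ x y → fill D x ≢ fill E y
    powers-clash x y with weight right | right-heavy | weight left | left-heavy
    ... | suc a | _ | suc b | _ = λ eq → clash _ _
      (trans (sym (fill-⊚ left (left ^ᶜ a) x)) (trans eq (fill-⊚ right (right ^ᶜ b) y)))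

    stack : 𝕋 τ → ∀ c → Fin (suc c) → 𝕋 τ
    stack u c       zero    = fill (E ^ᶜ c) u
    stack u (suc c) (suc i) = fill D (stack u c i)

    period : ℕ
    period = weight left * weight right

    size-stack : ∀ u c i → ∥ stack u c i ∥ ≡ c * period + ∥ u ∥
    size-stack u c zero = trans (size-fill (E ^ᶜ c) u)
      (cong (_+ ∥ u ∥) (trans (weight-^ᶜ E c) (cong (c *_) (weight-^ᶜ right (weight left)))))
    size-stack u (suc c) (suc i) = begin
      ∥ fill D (stack u c i) ∥         ≡⟨ size-fill D _ ⟩
      weight D + ∥ stack u c i ∥       ≡⟨ cong₂ _+_ weight-D (size-stack u c i) ⟩
      period + (c * period + ∥ u ∥)    ≡⟨ +-assoc period _ _ ⟨
      period + c * period + ∥ u ∥      ∎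
      where
      open ≡-Reasoning
      weight-D : weight D ≡ period
      weight-D = trans (weight-^ᶜ left (weight right)) (*-comm (weight right) (weight left))

    -- With `stack u c i` read as Dⁱ Eᶜ⁻ⁱ[u], the words of two different indices first differ where
    -- one has `D` and the other `E`.
    stack-injective : ∀ u c {i j} → stack u c i ≡ stack u c j → i ≡ j
    stack-injective u c       {zero}  {zero}  _  = refl
    stack-injective u (suc c) {zero}  {suc j} eq = contradiction
      (trans (sym eq) (fill-⊚ E (E ^ᶜ c) u)) (powers-clash _ _)
    stack-injective u (suc c) {suc i} {zero}  eq = contradiction
      (trans eq (fill-⊚ E (E ^ᶜ c) u)) (powers-clash _ _)
    stack-injective u (suc c) {suc i} {suc j} eq =
      cong suc (stack-injective u c (fill-injective D eq))

    many-stacks : ∀ c u → AtLeast (suc c) (TermOfSize 𝔸 (c * period + ∥ u ∥) τ)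
    many-stacks c u = mk↣ {to = λ i → stack u c i , size-stack u c i}
      (stack-injective u c ∘ cong proj₁)

    period-positive : 0 < period
    period-positive = *-mono-< left-heavy right-heavy

  OnLoop : Sort 𝔸 → Ctor 𝔸 → Set
  OnLoop τ f = Ctx (cod f) τ × Returns τ f

  onLoop? : ∀ τ f → Dec (OnLoop τ f)
  onLoop? τ f = reaches? (cod f) τ ×-dec returns? τ f

  -- A list of length other than 1 has a position besides `p`; two distinct terms placed there keep
  -- the results apart, whatever is put at `p`.
  two-fillings : (p : σ ∈ˡ xs) → length xs ≢ 1 →
    Σ[ ts ∈ All 𝕋 xs ] Σ[ us ∈ All 𝕋 xs ] ∀ x y → ts [ p ]≔ x ≢ us [ p ]≔ y
  two-fillings {xs = _ ∷ []} (here _) ≢1 = contradiction refl ≢1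
  two-fillings {xs = x ∷ x′ ∷ _} (here refl) _ =
    wd x ∷ to zero ∷ defaults , wd x ∷ to (suc zero) ∷ defaults ,
    λ _ _ eq → case injective (cong (All.head ∘ All.tail) eq) of λ ()
    where open Injection (two x′) using (to; injective)
  two-fillings {xs = x ∷ _} (there p) _ =
    to zero ∷ defaults , to (suc zero) ∷ defaults , λ _ _ eq → case injective (cong All.head eq) of λ ()
    where open Injection (two x) using (to; injective)

  clash-below : (H : Ctx σ τ) (K L : Ctx τ σ) → (∀ x y → fill K x ≢ fill L y) → Ambiguous τ
  clash-below H K L ≢ = record
    { left = H ⊚ K ; right = H ⊚ L
    ; clash = λ x y eq → ≢ x y (fill-injective H
        (trans (sym (fill-⊚ H K x)) (trans eq (fill-⊚ H L y)))) }

  nonunary⇒ambiguous : ∀ {f} → OnLoop τ f → ¬ Unary 𝔸 f → Ambiguous τ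
  nonunary⇒ambiguous {f = f} (H , a) ≢1 with find a
  ... | _ , p , K with two-fillings p ≢1
  ... | ts , us , ≢ = clash-below H (frame f p ts K) (frame f p us K) λ _ _ → ≢ _ _ ∘ con-injective

  rooted : ∀ {f} → cod f ≡ σ → Returns τ f → Σ[ K ∈ Ctx τ σ ] ∀ x → headSymbol 𝔸 (fill K x) ≡ f
  rooted {f = f} refl a with find a
  ... | _ , p , K = frame f p defaults K , λ _ → refl

  branching⇒ambiguous : ∀ {f g} → OnLoop τ f → OnLoop τ g → cod f ≡ cod g → f ≢ g → Ambiguous τ
  branching⇒ambiguous (H , a) (_ , b) eq f≢g with rooted refl a | rooted (sym eq) b
  ... | K , headK | L , headL = clash-below H K L
    λ x y eq → f≢g (trans (sym (headK x)) (trans (cong (headSymbol 𝔸) eq) (headL y)))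

  -- Contexts, step lists and walks in the dependency graph.

  depth : Ctx τ σ → ℕ
  depth □               = 0
  depth (frame _ _ _ K) = suc (depth K)

  steps : (K : Ctx τ σ) → Steps 𝔸 (depth K)
  steps □               = []
  steps (frame f _ _ K) = (cod f , f) ∷ steps K

  sortOf : Vertex 𝔸 → Sort 𝔸
  sortOf (inj₁ σ) = σ
  sortOf (inj₂ f) = cod f

  sortOf-vertices : ∀ {v} (K : Ctx τ σ) → v ∈ˡ vertices 𝔸 (steps K) → sortOf v ∈ˡ inits K
  sortOf-vertices (frame f p ts K) (here refl)         = here refl
  sortOf-vertices (frame f p ts K) (there (here refl)) = here refl
  sortOf-vertices (frame f p ts K) (there (there v∈))  = there (sortOf-vertices K v∈)

  -- A constructor determines its codomain, so distinct sorts along the path force distinct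
  -- constructors.
  unique-vertices : (K : Ctx τ σ) → Unique (inits K) → Unique (vertices 𝔸 (steps K))
  unique-vertices □                _        = []
  unique-vertices (frame f p ts K) (f∉ ∷ u) = ((λ ()) ∷ fresh refl) ∷ fresh refl ∷ unique-vertices K u
    where
    fresh : ∀ {v} → sortOf v ≡ cod f → All (v ≢_) (vertices 𝔸 (steps K))
    fresh eq = All.tabulate λ { w∈ refl → All.lookup f∉ (sortOf-vertices K w∈) (sym eq) }

  linked : ∀ {v} → Spine τ σ C → _⟶_ 𝔸 v (inj₁ σ) → Linked (_⟶_ 𝔸) (v ∷ (vertices 𝔸 C ∷ʳ inj₁ τ))
  linked []                          e = e ∷ [-]
  linked (link {f = f} refl p _ sp) e = e ∷ out f ∷ linked sp (arg p)

  unlink : ∀ {f} (C : Steps 𝔸 n) → (∀ i → Unary 𝔸 (ctorAt 𝔸 C i)) →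
    Linked (_⟶_ 𝔸) (inj₂ f ∷ (vertices 𝔸 C ∷ʳ inj₁ τ)) → ∃[ σ ] σ ∈ˡ dom f × Spine τ σ C
  unlink []            _  (arg p ∷ [-])         = _ , p , []
  unlink ((_ , g) ∷ C) un (arg p ∷ out _ ∷ es) with unlink C (un ∘ suc) es
  ... | _ , q , sp = _ , p , link refl q (un zero) sp

  cycle-spine : (C : Steps 𝔸 (suc n)) → let σ = sortAt 𝔸 C zero in
    IsCycleFrom 𝔸 (inj₁ σ) (vertices 𝔸 C) → (∀ i → Unary 𝔸 (ctorAt 𝔸 C i)) → Spine σ σ C
  cycle-spine ((_ , f) ∷ C) (_ , out _ ∷ es) un with unlink C (un ∘ suc) es
  ... | _ , p , sp = link refl p (un zero) sp

  -- An arbitrary walk to `τ`, with the alternation of sorts and constructors made explicit and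
  -- constructors of any arity allowed.
  data Run (τ : Sort 𝔸) : Sort 𝔸 → List (Vertex 𝔸) → Set where
    stop : σ ≡ τ → Run τ σ []
    step : ∀ {f} → cod f ≡ σ → ρ ∈ˡ dom f → Run τ ρ ws → Run τ σ (inj₁ σ ∷ inj₂ f ∷ ws)

  toRun : ∀ {f} ws → Linked (_⟶_ 𝔸) (inj₂ f ∷ (ws ∷ʳ inj₁ τ)) → ∃[ σ ] σ ∈ˡ dom f × Run τ σ ws
  toRun []                     (arg p ∷ [-]) = _ , p , stop refl
  toRun (inj₁ _ ∷ [])          (_ ∷ () ∷ _)
  toRun (inj₁ _ ∷ inj₁ _ ∷ ws) (_ ∷ () ∷ _)
  toRun (inj₁ _ ∷ inj₂ g ∷ ws) (arg p ∷ out _ ∷ es) with toRun ws es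
  ... | _ , q , r = _ , p , step refl q r
  toRun (inj₂ _ ∷ ws)          (() ∷ _)

  cycle-run : ∀ ws → IsCycleFrom 𝔸 (inj₁ τ) ws → Run τ τ ws
  cycle-run (inj₁ _ ∷ [])          (refl , () ∷ _)
  cycle-run (inj₁ _ ∷ inj₁ _ ∷ ws) (refl , () ∷ _)
  cycle-run (inj₁ _ ∷ inj₂ g ∷ ws) (refl , out _ ∷ es) with toRun ws es
  ... | _ , q , r = step refl q r

  runCtx : Run τ σ ws → Ctx τ σ
  runCtx (stop refl)               = □
  runCtx (step {f = f} refl p r) = frame f p defaults (runCtx r)

  unary-∈ : length xs ≡ 1 → ρ ∈ˡ xs → σ ∈ˡ xs → ρ ≡ σ
  unary-∈ {xs = _ ∷ []} _ (here refl) (here refl) = refl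

  avoiding-arg : ∀ {f s} B → suc (proj₁ arity-bound * B) < s → 𝕊-avoiding 𝔸 f σ s →
    ∃[ ρ ] ∃[ g ] g ≢ f × cod g ≡ σ × ρ ∈ˡ dom g ×
    Σ[ H ∈ Ctx ρ σ ] Σ[ v ∈ 𝕋 ρ ] ∥ fill H v ∥ ≡ s × B < ∥ v ∥
  avoiding-arg B (s≤s h) (con g ts , g≢f , refl) with big-arg-of B g ts h
  ... | _ , p , big = _ , g , g≢f , refl , p , frame g p ts □ , All.lookup ts p ,
    cong suc (cong (sizes 𝔸) (updateAt-id-local p ts refl)) , big

  -- The sort `ρ` is strictly lower, since it does not reach `τ`. Only the size of `t` is preserved:
  -- `v` need not be a subterm of `t`.
  Escapes : Sort 𝔸 → Set
  Escapes τ = ∀ B → ∃[ b ] ∀ (t : 𝕋 τ) → b < ∥ t ∥ →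
    ∃[ ρ ] Σ[ H ∈ Ctx ρ τ ] Σ[ v ∈ 𝕋 ρ ] ∥ fill H v ∥ ≡ ∥ t ∥ × B < ∥ v ∥ × ¬ Ctx τ ρ

  ContributingCycle : Set
  ContributingCycle = ∃[ n ] Σ[ C ∈ Steps 𝔸 (suc n) ]
    let σ¹ = sortAt 𝔸 C zero in
      IsSimpleCycleFrom 𝔸 (inj₁ σ¹) (vertices 𝔸 C)
    × IsOnlyCycleFrom 𝔸 (inj₁ σ¹) (vertices 𝔸 C)
    × (∀ i → Unary 𝔸 (ctorAt 𝔸 C i))
    × UnboundedlyContributes 𝔸 C σ¹

  units : Spine τ σ C → ∀ i → Unary 𝔸 (ctorAt 𝔸 C i)
  units (link _ _ u _)  zero    = u
  units (link _ _ _ sp) (suc i) = units sp i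

  -- Cycles with a sparse residue class.

  module _ {C : Steps 𝔸 (suc n)} (sp : Spine τ τ C) where
    open Cycle sp
    private
      N = suc n

    -- Wrap `base` in `bound + k` turns. A decomposition with at most `k` turns would leave an exit
    -- at least `bound` turns above `base`, hence of size at least `bound`.
    sparse⇒unbounded : Sparse → UnboundedlyContributes 𝔸 C τ
    sparse⇒unbounded sparse k (⊆ , _) with ⊆ (wrap (bound + k) (exit-term sp base∈))
      where open Sparse sparse
    ... | _ , a , (j , j≤k , refl) , a∈ , eq = contradiction
      (bounded (bound + k ∸ j) (subst (Exits C) a≡ a∈)) (≤⇒≯ late)
      where
      open Sparse sparse
      open ≡-Reasoning
      j≤bound+k : j ≤ bound + k
      j≤bound+k = ≤-trans j≤k (m≤n+m k bound)
      a≡ : a ≡ (bound + k ∸ j) * N + base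
      a≡ = +-cancelˡ-≡ (j * N) _ _ (begin
        j * N + a                                ≡⟨ eq ⟨
        (bound + k) * N + base                   ≡⟨ cong (λ x → x * N + base) (m+[n∸m]≡n j≤bound+k) ⟨
        (j + (bound + k ∸ j)) * N + base         ≡⟨ cong (_+ base) (*-distribʳ-+ N j _) ⟩
        j * N + (bound + k ∸ j) * N + base       ≡⟨ +-assoc (j * N) _ base ⟩
        j * N + ((bound + k ∸ j) * N + base)     ∎)
      late : bound ≤ (bound + k ∸ j) * N + base
      late = ≤-trans (m+n≤o⇒m≤o∸n bound (+-monoʳ-≤ bound j≤k)) (≤-trans (m≤m*n _ N) (m≤m+n _ base))

    -- Without an exit at size N + s, every term of that size wraps one of size s.
    unwrap-AtLeast : ∀ {m s} → ¬ Exits C (N + s) →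
      AtLeast m (TermOfSize 𝔸 (N + s) τ) → AtLeast m (TermOfSize 𝔸 s τ)
    unwrap-AtLeast {s = s} ∉ = AtLeast-↣ (mk↣ {to = λ t → proj₁ (core t)} λ {t} {u} eq →
      TermOfSize-≡ (trans (sym (proj₂ (core t)))
        (trans (cong (fill (toCtx sp) ∘ proj₁) eq) (proj₂ (core u)))))
      where
      core : ((t , _) : TermOfSize 𝔸 (N + s) τ) → Σ[ (u , _) ∈ TermOfSize 𝔸 s τ ] fill (toCtx sp) u ≡ t
      core (t , eq) with peel sp t
      ... | inj₂ t∈         = contradiction (subst (Exits C) eq t∈) ∉
      ... | inj₁ (u , refl) = (u , +-cancelˡ-≡ N _ _
        (trans (cong (_+ ∥ u ∥) (sym (weight-toCtx sp))) (trans (sym (size-fill (toCtx sp) u)) eq))) , refl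

    -- From `bound` turns on, the class of `base` has no exits, so further turns create no new
    -- terms, while wrapping `base` shows that the class never becomes empty.
    sparse⇒¬expanding : Sparse → ¬ ExpandingSort 𝔸 τ
    sparse⇒¬expanding sparse expanding with TermOfSize-finite (bound * N + base) τ
      where open Sparse sparse
    ... | m , ¬many with expanding m
    ... | b , large = [ (λ ∅ → ∅ (wrap (b + bound) (exit-term sp base∈))) , ¬many ∘ descend b ]′
      (large ((b + bound) * N + base) (≤-trans (m≤m+n b bound) (≤-trans (m≤m*n _ N) (m≤m+n _ base))))
      where
      open Sparse sparse
      descend : ∀ j → AtLeast m (TermOfSize 𝔸 ((j + bound) * N + base) τ) →
        AtLeast m (TermOfSize 𝔸 (bound * N + base) τ)
      descend zero    many = many
      descend (suc j) many = descend j (unwrap-AtLeast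
        (λ x∈ → ≤⇒≯ late (bounded (suc j + bound) (subst (Exits C) (sym assoc) x∈)))
        (subst (λ s → AtLeast m (TermOfSize 𝔸 s τ)) assoc many))
        where
        assoc : (suc j + bound) * N + base ≡ N + ((j + bound) * N + base)
        assoc = +-assoc N ((j + bound) * N) base
        late : bound ≤ (suc j + bound) * N + base
        late = ≤-trans (m≤n+m bound (suc j)) (≤-trans (m≤m*n _ N) (m≤m+n _ base))

  -- The unique unary cycle through a sort.

  module Unambiguous {f₀}
    (unary : ∀ f → OnLoop (cod f₀) f → Unary 𝔸 f)
    (unique : ∀ {f g} → OnLoop (cod f₀) f → OnLoop (cod f₀) g → cod f ≡ cod g → f ≡ g) where

    τ₀ : Sort 𝔸
    τ₀ = cod f₀

    -- The second argument accumulates the way from `τ₀` down to `σ`, which certifies that each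
    -- constructor of `K` is on a loop and hence unary.
    spine : (K : Ctx τ₀ σ) → Ctx σ τ₀ → Spine τ₀ σ (steps K)
    spine □                _ = []
    spine (frame f p _ K) H =
      link refl p (unary f (H , lose p K)) (spine K (H ⊚ frame f p defaults □))

    module _ {σ₁} (p₀ : σ₁ ∈ˡ dom f₀) (K₀ : Ctx τ₀ σ₁) (s : Simple K₀) where
      C₀ : Steps 𝔸 (suc (depth K₀))
      C₀ = (τ₀ , f₀) ∷ steps K₀

      H₀ : Ctx σ₁ τ₀
      H₀ = frame f₀ p₀ defaults □

      onLoop₀ : OnLoop τ₀ f₀
      onLoop₀ = □ , lose p₀ K₀

      spine₀ : Spine τ₀ τ₀ C₀
      spine₀ = link refl p₀ (unary f₀ onLoop₀) (spine K₀ H₀)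

      -- `K` is the rest of the current turn. The walk returns to `τ₀`, so its next constructor is
      -- on a loop: `unique` identifies it with that of the cycle, and unarity fixes the next sort.
      -- Stopping inside a turn is impossible, as `τ₀` does not occur in `inits K`.
      follow : (K : Ctx τ₀ σ) → All (τ₀ ≢_) (inits K) → Ctx σ τ₀ → Run τ₀ σ ws →
        ∃[ r ] ws ≡ vertices 𝔸 (steps K) ++ concat (replicate r (vertices 𝔸 C₀))
      follow □ _ H (stop _) = 0 , refl
      follow □ _ H (step e q r)
        with unique (subst (λ σ → Ctx σ τ₀) (sym e) H , lose q (runCtx r)) onLoop₀ e
      ... | refl with unary-∈ (unary f₀ onLoop₀) q p₀
      ... | refl with follow K₀ (case s of λ { (τ∉ ∷ _) → τ∉ }) H₀ r
      ... | m , refl = suc m , refl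
      follow (frame f p _ K) (τ≢ ∷ _)  H (stop e) = contradiction (sym e) τ≢
      follow (frame f p _ K) (_ ∷ τ∉) H (step e q r)
        with on ← H , lose p K
        with unique (subst (λ σ → Ctx σ τ₀) (sym e) H , lose q (runCtx r)) on e
      ... | refl with unary-∈ (unary f on) q p
      ... | refl with follow K τ∉ (H ⊚ frame f p defaults □) r
      ... | m , refl = m , refl

      onlyCycle : IsOnlyCycleFrom 𝔸 (inj₁ τ₀) (vertices 𝔸 C₀)
      onlyCycle ws cyc = follow □ [] □ (cycle-run ws cyc)

      simpleCycle : IsSimpleCycleFrom 𝔸 (inj₁ τ₀) (vertices 𝔸 C₀)
      simpleCycle = (refl , out f₀ ∷ linked (spine K₀ H₀) (arg p₀)) ,
                    unique-vertices (frame f₀ p₀ defaults K₀) s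

      bounded⇒escapes : ∀ {k} → Cycle.Bounded spine₀ k → Escapes τ₀
      -- The threshold covers at most `k` turns, an offset below `N`, and the size from which an
      -- exiting term has an argument larger than `B`.
      bounded⇒escapes {k} (⊆ , _) B = k * N + (N + suc (proj₁ arity-bound * B)) , go
        where
        N = suc (depth K₀)
        go : ∀ t → k * N + (N + suc (proj₁ arity-bound * B)) < ∥ t ∥ →
          ∃[ ρ ] Σ[ H ∈ Ctx ρ τ₀ ] Σ[ v ∈ 𝕋 ρ ] ∥ fill H v ∥ ≡ ∥ t ∥ × B < ∥ v ∥ × ¬ Ctx τ₀ ρ
        go t h with ⊆ (t , refl)
        ... | _ , _ , (j , j≤k , refl) , (i , x , x∈ , refl) , eq with
          avoiding-arg B (+-cancelˡ-< (k * N + N) _ _ (<-≤-trans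
            (subst (_< ∥ t ∥) (sym (+-assoc (k * N) N _)) h)
            (≤-trans (≤-reflexive eq) (≤-trans
              (+-mono-≤ (*-monoˡ-≤ N j≤k)
                (≤-trans (≤-reflexive (+-comm x (toℕ i))) (+-monoˡ-≤ x (<⇒≤ (Fin.toℕ<n i)))))
              (≤-reflexive (sym (+-assoc (k * N) N x))))))) x∈
        ... | ρ , g , g≢f , cod≡g , p , H , v , ∥Hv∥ , B<v =
          -- If `ρ` led back to `τ₀`, then `g` and the cycle constructor at position `i` would be
          -- distinct loop constructors of equal codomain.
          ρ , toCtx spine₀ ^ᶜ j ⊚ ctx ⊚ H , v , size≡ , B<v , λ K → g≢f (unique
            (subst (λ σ → Ctx σ τ₀) (sym cod≡g) ctx , lose p K)
            (subst (λ σ → Ctx σ τ₀) (sym cod≡) ctx , returns) (trans cod≡g (sym cod≡)))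
          where
          open Prefix (prefix spine₀ i)
          open ≡-Reasoning
          L = toCtx spine₀
          weight-turns : weight (L ^ᶜ j) ≡ j * N
          weight-turns = trans (weight-^ᶜ L j) (cong (j *_) (weight-toCtx spine₀))
          size-outer : ∥ fill (ctx ⊚ H) v ∥ ≡ weight ctx + ∥ fill H v ∥
          size-outer = trans (cong ∥_∥ (fill-⊚ ctx H v)) (size-fill ctx _)
          size≡ : ∥ fill (L ^ᶜ j ⊚ ctx ⊚ H) v ∥ ≡ ∥ t ∥
          size≡ = begin
            ∥ fill (L ^ᶜ j ⊚ ctx ⊚ H) v ∥              ≡⟨ cong ∥_∥ (fill-⊚ (L ^ᶜ j) (ctx ⊚ H) v) ⟩
            ∥ fill (L ^ᶜ j) (fill (ctx ⊚ H) v) ∥       ≡⟨ size-fill (L ^ᶜ j) _ ⟩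
            weight (L ^ᶜ j) + ∥ fill (ctx ⊚ H) v ∥     ≡⟨ cong₂ _+_ weight-turns size-outer ⟩
            j * N + (weight ctx + ∥ fill H v ∥)        ≡⟨ cong (λ s → j * N + s) (cong₂ _+_ offset ∥Hv∥) ⟩
            j * N + (toℕ i + x)                        ≡⟨ cong (j * N +_) (+-comm (toℕ i) x) ⟩
            j * N + (x + toℕ i)                        ≡⟨ eq ⟨
            ∥ t ∥                                      ∎

      contributes-or-escapes : ContributingCycle ⊎ Escapes τ₀
      contributes-or-escapes = [ inj₂ ∘ bounded⇒escapes ∘ proj₂ , inj₁ ∘ contributes ]′
        (Cycle.dichotomy spine₀)
        where
        contributes : Cycle.Sparse spine₀ → ContributingCycle
        contributes sparse =
          _ , C₀ , simpleCycle , onlyCycle , units spine₀ , sparse⇒unbounded spine₀ sparse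

  -- Classification of sorts.

  data Tame (τ : Sort 𝔸) : Set where
    acyclic   : ¬ Cyclic τ → Tame τ
    ambiguous : Ambiguous τ → Tame τ
    escapes   : Escapes τ → Tame τ

  classify : ∀ τ → ContributingCycle ⊎ Tame τ
  classify τ with cyclic? τ
  ... | no ¬c = inj₂ (acyclic ¬c)
  ... | yes (f₀ , refl , a) with Fin.any? (λ f → onLoop? τ f ×-dec ¬? (length (dom f) ≟ 1))
  ... | yes (f , on , ≢1) = inj₂ (ambiguous (nonunary⇒ambiguous on ≢1))
  ... | no unary with Fin.any? (λ f → Fin.any? λ g →
                        onLoop? τ f ×-dec onLoop? τ g ×-dec (cod f Fin.≟ cod g) ×-dec ¬? (f Fin.≟ g))
  ... | yes (f , g , onf , ong , eq , f≢g) = inj₂ (ambiguous (branching⇒ambiguous onf ong eq f≢g))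
  ... | no unique with find a
  ... | _ , p₀ , K with simplify K
  ... | K₀ , s = [ inj₁ , inj₂ ∘ escapes ]′ (contributes-or-escapes p₀ K₀ s)
    where open Unambiguous {f₀}
            (λ f on → decidable-stable (length (dom f) ≟ 1) λ ≢1 → unary (f , on , ≢1))
            (λ {f} {g} onf ong eq → decidable-stable (f Fin.≟ g)
              λ f≢g → unique (f , g , onf , ong , eq , f≢g))

  -- Many terms of equal size.

  module _ (tame : ∀ τ → Tame τ) (N : ℕ) where

    Rich : Sort 𝔸 → ℕ → Set
    Rich σ b = ∀ (t : 𝕋 σ) → b < ∥ t ∥ → AtLeast N (TermOfSize 𝔸 ∥ t ∥ σ)

    Rich-≤ : ∀ {b c} → b ≤ c → Rich σ b → Rich σ c
    Rich-≤ b≤c rich t c<t = rich t (≤-<-trans b≤c c<t)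

    AtLeast-refill : ∀ {u : 𝕋 σ} (H : Ctx ρ σ) (v : 𝕋 ρ) → ∥ fill H v ∥ ≡ ∥ u ∥ →
      AtLeast N (TermOfSize 𝔸 ∥ v ∥ ρ) → AtLeast N (TermOfSize 𝔸 ∥ u ∥ σ)
    AtLeast-refill {σ = σ} H v eq many = subst (λ s → AtLeast N (TermOfSize 𝔸 s σ))
      (trans (sym (size-fill H v)) eq) (AtLeast-fill H many)

    loops-rich : ∀ τ → (∃[ B ] ∀ ρ → Ctx ρ τ → ¬ Ctx τ ρ → Rich ρ B) →
      ∃[ w ] 0 < w × ∀ (K : Ctx τ τ) (y : 𝕋 τ) → w ∣ weight K → 0 < weight K →
        AtLeast N (TermOfSize 𝔸 ∥ fill K y ∥ τ)
    loops-rich τ (B , lower) with tame τ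
    ... | acyclic ¬c = 1 , s≤s z≤n , λ K _ _ K>0 → contradiction (cyclic K K>0) ¬c
    -- A positive multiple of this weight is worth at least `suc N` periods, so stacks on `y` of the
    -- size of `fill K y` are numerous enough.
    ... | ambiguous am = suc N * period am , *-mono-< (s≤s (z≤n {N})) (period-positive am) , go
      where
      go : ∀ (K : Ctx τ τ) y → suc N * period am ∣ weight K → 0 < weight K →
        AtLeast N (TermOfSize 𝔸 ∥ fill K y ∥ τ)
      go K y (divides zero    eq) K>0 = contradiction (subst (0 <_) eq K>0) λ ()
      go K y (divides (suc d) eq) _   = subst (λ s → AtLeast N (TermOfSize 𝔸 s τ))
        (trans (cong (_+ ∥ y ∥) (trans (*-assoc (suc d) (suc N) _) (sym eq))) (sym (size-fill K y)))
        (AtLeast-≤ (m≤n⇒m≤1+n (≤-trans (n≤1+n N) (m≤m+n (suc N) (d * suc N))))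
          (many-stacks am (suc d * suc N) y))
    ... | escapes esc with esc B
    -- A positive multiple of `suc b` exceeds `b`, so `escape` applies to `fill K y`.
    ...   | b , escape = suc b , s≤s z≤n , go
      where
      go : ∀ (K : Ctx τ τ) y → suc b ∣ weight K → 0 < weight K →
        AtLeast N (TermOfSize 𝔸 ∥ fill K y ∥ τ)
      go K y b∣ K>0 with escape (fill K y) (≤-trans (∣⇒≤ {{>-nonZero K>0}} b∣)
                           (≤-trans (m≤m+n _ ∥ y ∥) (≤-reflexive (sym (size-fill K y)))))
      ... | ρ , H , v , eq , B<v , ¬back = AtLeast-refill H v eq (lower ρ H ¬back v B<v)

    -- The induction is on a set `U` containing every sort reachable from `σ`; it shrinks on passing
    -- to a strictly lower sort.
    rich : ∀ {U} → Acc _⊂_ U → ∀ σ → (∀ {τ} → Ctx τ σ → τ Subset.∈ U) → ∃[ b ] Rich σ b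
    rich {U} (acc rec) σ reach = proj₁ pumped , λ t h → go (proj₂ pumped t h)
      where
      lower : ∀ τ → Ctx τ σ → ∃[ B ] ∀ ρ → Ctx ρ τ → ¬ Ctx τ ρ → Rich ρ B
      lower τ G = finite-bound (λ b≤c h K ¬L → Rich-≤ b≤c (h K ¬L)) below
        where
        below : ∀ ρ → ∃[ B ] (Ctx ρ τ → ¬ Ctx τ ρ → Rich ρ B)
        below ρ with reaches? ρ τ | reaches? τ ρ
        ... | no ¬K | _     = 0 , λ K _ → contradiction K ¬K
        ... | yes _ | yes L = 0 , λ _ ¬L → contradiction L ¬L
        ... | yes K | no ¬L with rich (rec (x∈p⇒p-x⊂p (reach G))) ρ
                              (λ M → x∈p∧x≢y⇒x∈p-y (reach (G ⊚ K ⊚ M)) λ { refl → ¬L M })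
        ...   | B , h = B , λ _ _ → h

      loop : ∀ τ → ∃[ w ] 0 < w × (Ctx τ σ → ∀ (K : Ctx τ τ) (y : 𝕋 τ) → w ∣ weight K → 0 < weight K →
        AtLeast N (TermOfSize 𝔸 ∥ fill K y ∥ τ))
      loop τ with reaches? τ σ
      ... | no ¬G = 1 , s≤s z≤n , λ G → contradiction G ¬G
      ... | yes G with loops-rich τ (lower τ G)
      ...   | w , w>0 , h = w , w>0 , λ _ → h

      -- The sort of the loop is known only after pumping with `Q`, so `Q` has to suit all sorts at
      -- once; unreachable ones contribute `1`.
      multiple = common-multiple (proj₁ ∘ loop) (proj₁ ∘ proj₂ ∘ loop)
      Q = proj₁ multiple
      pumped = pump Q (proj₁ (proj₂ multiple))

      go : ∀ {t : 𝕋 σ} → Pumped Q t → AtLeast N (TermOfSize 𝔸 ∥ t ∥ σ)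
      go record { loopSort = τ ; outer = G ; inner = K ; core = y ; splits = refl
                ; c = c ; weight-loop = eq } =
        AtLeast-refill G (fill K y) refl (proj₂ (proj₂ (loop τ)) G K y
          (∣-trans (proj₂ (proj₂ multiple) τ) (divides (suc c) eq))
          (subst (0 <_) (sym eq) (<-≤-trans (proj₁ (proj₂ multiple)) (m≤m+n Q (c * Q)))))

  -- The two directions of the equivalence.

  tame⇒expanding : (∀ τ → Tame τ) → Expanding 𝔸
  tame⇒expanding tame σ n with rich tame n (⊂-wellFounded ⊤) σ (λ _ → ∈⊤)
  ... | b , h = suc b , go
    where
    go : ∀ b′ → b < b′ → (¬ TermOfSize 𝔸 b′ σ) ⊎ AtLeast n (TermOfSize 𝔸 b′ σ)
    go b′ b<b′ with TermOfSize? b′ σ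
    ... | no ∅           = inj₁ ∅
    ... | yes (t , refl) = inj₂ (h t b<b′)

  -- The classification is effective: it either produces a cycle or shows all sorts tame, so the
  -- negated hypothesis suffices constructively.
  ¬expanding⇒cycle : ¬ Expanding 𝔸 → ContributingCycle
  ¬expanding⇒cycle ¬exp with finite-choice classify
  ... | inj₁ cycle = cycle
  ... | inj₂ tame  = contradiction (tame⇒expanding tame) ¬exp

  -- Unbounded contribution rules out the bounded side of the dichotomy, and the sparse side refutes
  -- expansion at the first sort of the cycle.
  cycle⇒¬expanding : ContributingCycle → ¬ Expanding 𝔸
  cycle⇒¬expanding (_ , C , (isCycle , _) , _ , unary , unbounded) expanding =
    [ (λ (k , bounded) → unbounded k bounded)
    , (λ sparse → sparse⇒¬expanding sp sparse (expanding _)) ]′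
    (Cycle.dichotomy sp)
    where sp = cycle-spine C isCycle unary

theorem2 : (𝔸 : ADT) → WellDefined 𝔸 → (∀ σ → AtLeast 2 (Term 𝔸 σ)) →
    (¬ Expanding 𝔸) ⇔
    (∃[ n ] Σ[ C ∈ Steps 𝔸 (suc n) ]
    let σ¹ = sortAt 𝔸 C zero in
    IsSimpleCycleFrom 𝔸 (inj₁ σ¹) (vertices 𝔸 C)
    × IsOnlyCycleFrom 𝔸 (inj₁ σ¹) (vertices 𝔸 C)
    × (∀ i → Unary 𝔸 (ctorAt 𝔸 C i))
    × UnboundedlyContributes 𝔸 C σ¹)
theorem2 𝔸 wd two = mk⇔ ¬expanding⇒cycle cycle⇒¬expanding
  where open Classify 𝔸 wd two
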